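{- Let $\mathbf{L}=\langle L,\vee,\wedge,{}',0,1\rangle$ be an orthomodular lattice. Define $x+y=x\vee y$ and $x\cdot y=(x\vee y')\wedge y$ (the Sasaki projection) for $x,y\in L$. Then $\mathbf{R}(\mathbf{L})=\langle L,+,\cdot,{}',0,1\rangle$ (with $\alpha(x)=x'$) is an orthomodular near semiring.
   Context: An orthomodular lattice is an algebra $\langle L,\vee,\wedge,{}',0,1\rangle$ such that $\langle L,\vee,\wedge,0,1\rangle$ is a bounded lattice, $x\wedge x'=0$, $x\vee x'=1$, $x''=x$, $x\le y$ implies $y'\le x'$, and $x\le y$ implies $y=x\vee(y\wedge x')$. A near semiring is an algebra $\langle R,+,\cdot,0,1\rangle$ such that: (i) $\langle R,+,0\rangle$ is a commutative monoid; (ii) $x\cdot 1=x=1\cdot x$ (multiplication need not be associative or commutative); (iii) $(x+y)\cdot z=(x\cdot z)+(y\cdot z)$; (iv) $x\cdot 0=0\cdot x=0$. It is idempotent if $x+x=x$; then $x\le y$ iff $x+y=y$ defines a partial order, called the induced order. An involutive near semiring is an idempotent near semiring with a map $\alpha:R\to R$ such that $\alpha(\alpha(x))=x$, and $x\le y$ implies $\alpha(y)\le\alpha(x)$. A Łukasiewicz near semiring is an involutive near semiring satisfying the identity $\alpha(x\cdot\alpha(y))\cdot\alpha(y)=\alpha(y\cdot\alpha(x))\cdot\alpha(x)$. An orthomodular near semiring is a Łukasiewicz near semiring satisfying the identity $x=x\cdot(x+y)$. -}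

module Defs where

open import Level using (Level; _⊔_; suc)
open import Relation.Binary.Core using (Rel)
open import Algebra.Core using (Op₁; Op₂)
import Algebra.Definitions as Definitions
open import Algebra.Structures using (IsCommutativeMonoid)
open import Algebra.Lattice.Structures using (IsLattice)

-- As in the library's algebraic hierarchy, equality is an arbitrary
-- equivalence _≈_ and every operation is required to respect it; taking
-- _≈_ to be _≡_ gives the usual notions.

module _ {a ℓ} {A : Set a} (_≈_ : Rel A ℓ) where

  open Definitions _≈_

  record IsOrthomodularLattice (_∨_ _∧_ : Op₂ A) (_′ : Op₁ A) (0# 1# : A)
         : Set (a ⊔ ℓ) where

    infix 4 _≤_
    _≤_ : Rel A ℓ
    x ≤ y = (x ∧ y) ≈ x

    field
      isLattice    : IsLattice _≈_ _∨_ _∧_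
      ∨-identity   : Identity 0# _∨_
      ∧-identity   : Identity 1# _∧_
      ′-cong       : Congruent₁ _′
      ∧-complement : ∀ x → (x ∧ (x ′)) ≈ 0#
      ∨-complement : ∀ x → (x ∨ (x ′)) ≈ 1#
      ′-involutive : Involutive _′
      ′-antitone   : ∀ {x y} → x ≤ y → y ′ ≤ x ′
      orthomodular : ∀ {x y} → x ≤ y → y ≈ (x ∨ (y ∧ (x ′)))

    open IsLattice isLattice public

  -- This is not the library's IsNearSemiring, which demands associative
  -- multiplication but has neither 1#, nor commutativity of +, nor x * 0# ≈ 0#.
  record IsNearSemiring (+ * : Op₂ A) (0# 1# : A) : Set (a ⊔ ℓ) where
    field
      +-isCommutativeMonoid : IsCommutativeMonoid _≈_ + 0#
      *-cong                : Congruent₂ *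
      *-identity            : Identity 1# *
      distribʳ              : * DistributesOverʳ +
      zero                  : Zero 0# *

  record IsIdempotentNearSemiring (+ * : Op₂ A) (0# 1# : A) : Set (a ⊔ ℓ) where
    field
      isNearSemiring : IsNearSemiring + * 0# 1#
      +-idem         : Idempotent +

    open IsNearSemiring isNearSemiring public

  record IsInvolutiveNearSemiring (_+_ _*_ : Op₂ A) (α : Op₁ A) (0# 1# : A)
         : Set (a ⊔ ℓ) where

    infix 4 _≤_
    _≤_ : Rel A ℓ
    x ≤ y = (x + y) ≈ y

    field
      isIdempotentNearSemiring : IsIdempotentNearSemiring _+_ _*_ 0# 1#
      α-cong                   : Congruent₁ α
      α-involutive             : Involutive α
      α-antitone               : ∀ {x y} → x ≤ y → α y ≤ α x

    open IsIdempotentNearSemiring isIdempotentNearSemiring public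

  record IsŁukasiewiczNearSemiring (_+_ _*_ : Op₂ A) (α : Op₁ A) (0# 1# : A)
         : Set (a ⊔ ℓ) where
    field
      isInvolutiveNearSemiring : IsInvolutiveNearSemiring _+_ _*_ α 0# 1#
      łukasiewicz              : ∀ x y →
        (α (x * α y) * α y) ≈ (α (y * α x) * α x)

    open IsInvolutiveNearSemiring isInvolutiveNearSemiring public

  record IsOrthomodularNearSemiring (_+_ _*_ : Op₂ A) (α : Op₁ A) (0# 1# : A)
         : Set (a ⊔ ℓ) where
    field
      isŁukasiewiczNearSemiring : IsŁukasiewiczNearSemiring _+_ _*_ α 0# 1#
      *-absorbs-+               : ∀ x y → x ≈ (x * (x + y))

    open IsŁukasiewiczNearSemiring isŁukasiewiczNearSemiring public

record OrthomodularLattice (c ℓ : Level) : Set (suc (c ⊔ ℓ)) where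
  infix  8 _′
  infixr 7 _∧_
  infixr 6 _∨_
  infix  4 _≈_
  field
    Carrier               : Set c
    _≈_                   : Rel Carrier ℓ
    _∨_ _∧_               : Op₂ Carrier
    _′                    : Op₁ Carrier
    0# 1#                 : Carrier
    isOrthomodularLattice : IsOrthomodularLattice _≈_ _∨_ _∧_ _′ 0# 1#

  open IsOrthomodularLattice isOrthomodularLattice public

  sasaki : Op₂ Carrier
  sasaki x y = (x ∨ y ′) ∧ y

{-# OPTIONS --safe #-}

-- Two facts carry the proof. Orthomodularity dualises to w ≈ z ∧ (w ∨ z ′) for
-- w ≤ z, which makes each side of the Łukasiewicz identity the symmetric
-- expression x ′ ∧ y ′ and also gives x ≈ x · (x ∨ y). Moreover, for w ≤ z,
-- x · z ≤ w holds iff x ≤ z ′ ∨ w, so _· z preserves joins as a lower adjoint.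

module Submission where

open import Defs
import Algebra.Definitions as Definitions
import Algebra.Lattice.Bundles as Algebraic
import Algebra.Lattice.Properties.Lattice as AlgebraicLatticeProperties
open import Data.Product.Base using (_,_; proj₁; proj₂)
import Relation.Binary.Lattice as OrderTheoretic
import Relation.Binary.Lattice.Properties.BoundedLattice as BoundedLatticeProperties
import Relation.Binary.Lattice.Properties.JoinSemilattice as JoinSemilatticeProperties
import Relation.Binary.Lattice.Properties.MeetSemilattice as MeetSemilatticeProperties
import Relation.Binary.Reasoning.PartialOrder as PartialOrderReasoning
import Relation.Binary.Reasoning.Setoid as SetoidReasoning

module OrthomodularLatticeProperties {c ℓ} (L : OrthomodularLattice c ℓ) where

  open OrthomodularLattice L hiding (_≤_)
  open Definitions _≈_

  lattice : Algebraic.Lattice c ℓ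
  lattice = record { isLattice = isLattice }

  open AlgebraicLatticeProperties lattice
    using (∨-idem; ∨-isSemigroup; ∨-∧-isOrderTheoreticLattice)

  -- The library's order is x ≈ x ∧ y, the symmetric form of the one in Defs.
  orderTheoreticBoundedLattice : OrderTheoretic.BoundedLattice c ℓ ℓ
  orderTheoreticBoundedLattice = record
    { isBoundedLattice = record
      { isLattice = ∨-∧-isOrderTheoreticLattice
      ; maximum   = λ x → sym (proj₂ ∧-identity x)
      ; minimum   = λ x → trans (sym (∧-absorbs-∨ 0# x)) (∧-congˡ (proj₁ ∨-identity x))
      }
    }

  open OrderTheoretic.BoundedLattice orderTheoreticBoundedLattice
    using (_≤_; poset; antisym; joinSemilattice; meetSemilattice
          ; x≤x∨y; y≤x∨y; ∨-least; x∧y≤x; x∧y≤y; ∧-greatest)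
    renaming (refl to ≤-refl; trans to ≤-trans; reflexive to ≤-reflexive)
  open BoundedLatticeProperties orderTheoreticBoundedLattice using (∧-zeroʳ; ∨-zeroˡ)
  open JoinSemilatticeProperties joinSemilattice using (∨-monotonic; x≤y⇒x∨y≈y)
  open MeetSemilatticeProperties meetSemilattice using (∧-monotonic)

  ′-anti-≤ : ∀ {x y} → x ≤ y → y ′ ≤ x ′
  ′-anti-≤ x≤y = sym (′-antitone (sym x≤y))

  -- An antitone involution is an order anti-isomorphism, so it exchanges least upper bounds with
  -- greatest lower bounds.
  deMorgan-∨ : ∀ x y → (x ∨ y) ′ ≈ x ′ ∧ y ′
  deMorgan-∨ x y = antisym
    (∧-greatest (′-anti-≤ (x≤x∨y x y)) (′-anti-≤ (y≤x∨y x y)))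
    (≤-trans (≤-reflexive (sym (′-involutive _)))
      -- After rewriting `x ′ ∧ y ′` as a double complement it suffices that its complement bounds
      -- `x` and `y` from above; `swap-′` reduces this to the two meet projections.
      (′-anti-≤ (∨-least (swap-′ (x∧y≤x _ _)) (swap-′ (x∧y≤y _ _)))))
    where
    swap-′ : ∀ {u v} → v ≤ u ′ → u ≤ v ′
    swap-′ v≤u′ = ≤-trans (≤-reflexive (sym (′-involutive _))) (′-anti-≤ v≤u′)

  deMorgan-∧ : ∀ x y → (x ∧ y) ′ ≈ x ′ ∨ y ′
  deMorgan-∧ x y = begin
    (x ∧ y) ′              ≈⟨ ′-cong (∧-cong (′-involutive x) (′-involutive y)) ⟨
    ((x ′) ′ ∧ (y ′) ′) ′  ≈⟨ ′-cong (deMorgan-∨ (x ′) (y ′)) ⟨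
    ((x ′ ∨ y ′) ′) ′      ≈⟨ ′-involutive _ ⟩
    x ′ ∨ y ′              ∎
    where open SetoidReasoning (Algebraic.Lattice.setoid lattice)

  1′≈0 : 1# ′ ≈ 0#
  1′≈0 = trans (sym (proj₁ ∧-identity _)) (∧-complement 1#)

  -- Since `z ′ ≤ w ′`, the orthomodular law decomposes `w ′` as `z ′ ∨ (w ′ ∧ (z ′) ′)`;
  -- complementing this gives the claim.
  sasaki-fixes-≤ : ∀ {w z} → w ≤ z → sasaki w z ≈ w
  sasaki-fixes-≤ {w} {z} w≤z = begin
    (w ∨ z ′) ∧ z                ≈⟨ ∧-comm _ _ ⟩
    -- Double complements are inserted so that the two De Morgan laws can fold the whole term into a
    -- single complement.
    z ∧ (w ∨ z ′)                ≈⟨ ∧-cong (′-involutive z) (∨-congʳ (′-involutive w)) ⟨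
    (z ′) ′ ∧ ((w ′) ′ ∨ z ′)    ≈⟨ ∧-congˡ (∨-congˡ (′-involutive (z ′))) ⟨
    (z ′) ′ ∧ ((w ′) ′ ∨ ((z ′) ′) ′)  ≈⟨ ∧-congˡ (deMorgan-∧ (w ′) ((z ′) ′)) ⟨
    (z ′) ′ ∧ (w ′ ∧ (z ′) ′) ′  ≈⟨ deMorgan-∨ (z ′) (w ′ ∧ (z ′) ′) ⟨
    (z ′ ∨ (w ′ ∧ (z ′) ′)) ′    ≈⟨ ′-cong (orthomodular (sym (′-anti-≤ w≤z))) ⟨
    (w ′) ′                      ≈⟨ ′-involutive w ⟩
    w                            ∎
    where open SetoidReasoning (Algebraic.Lattice.setoid lattice)

  sasaki-cong : Congruent₂ sasaki
  sasaki-cong x≈y u≈v = ∧-cong (∨-cong x≈y (′-cong u≈v)) u≈v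

  sasaki-monoˡ-≤ : ∀ z {x y} → x ≤ y → sasaki x z ≤ sasaki y z
  sasaki-monoˡ-≤ z x≤y = ∧-monotonic (∨-monotonic x≤y ≤-refl) ≤-refl

  -- The unit of the adjunction: the orthomodular law for `z ′ ≤ x ∨ z ′` produces the projection as
  -- the relative complement.
  x≤z′∨sasaki : ∀ x z → x ≤ z ′ ∨ sasaki x z
  x≤z′∨sasaki x z = begin
    x                              ≤⟨ x≤x∨y x (z ′) ⟩
    x ∨ z ′                        ≈⟨ orthomodular (sym (y≤x∨y x (z ′))) ⟩
    z ′ ∨ ((x ∨ z ′) ∧ (z ′) ′)    ≈⟨ ∨-congˡ (∧-congˡ (′-involutive z)) ⟩
    z ′ ∨ sasaki x z               ∎
    where open PartialOrderReasoning poset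

  x≤z′∨w⇒sasaki≤w : ∀ {x w z} → w ≤ z → x ≤ z ′ ∨ w → sasaki x z ≤ w
  x≤z′∨w⇒sasaki≤w {x} {w} {z} w≤z x≤z′∨w = begin
    (x ∨ z ′) ∧ z  ≤⟨ ∧-monotonic (∨-least x≤w∨z′ (y≤x∨y w (z ′))) ≤-refl ⟩
    (w ∨ z ′) ∧ z  ≈⟨ sasaki-fixes-≤ w≤z ⟩
    w              ∎
    where
    open PartialOrderReasoning poset
    x≤w∨z′ : x ≤ w ∨ z ′
    x≤w∨z′ = ≤-trans x≤z′∨w (≤-reflexive (∨-comm (z ′) w))

  -- For the nontrivial inequality take `w` to be the join of the two projections: it lies below
  -- `z`, and the units for `x` and `y` put `x ∨ y` below `z ′ ∨ w`.
  sasaki-distribʳ-∨ : sasaki DistributesOverʳ _∨_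
  sasaki-distribʳ-∨ z x y = antisym
    (x≤z′∨w⇒sasaki≤w (∨-least (x∧y≤y _ z) (x∧y≤y _ z))
      (∨-least
        (≤-trans (x≤z′∨sasaki x z) (∨-monotonic ≤-refl (x≤x∨y _ _)))
        (≤-trans (x≤z′∨sasaki y z) (∨-monotonic ≤-refl (y≤x∨y _ _)))))
    (∨-least (sasaki-monoˡ-≤ z (x≤x∨y x y)) (sasaki-monoˡ-≤ z (y≤x∨y x y)))

  sasaki-identity : Identity 1# sasaki
  sasaki-identity =
      (λ x → trans (∧-congʳ (∨-zeroˡ (x ′))) (proj₁ ∧-identity x))
    , (λ x → trans (proj₂ ∧-identity _) (trans (∨-congˡ 1′≈0) (proj₂ ∨-identity x)))

  sasaki-zero : Zero 0# sasaki
  sasaki-zero =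
      (λ x → trans (∧-congʳ (proj₁ ∨-identity (x ′))) (trans (∧-comm _ _) (∧-complement x)))
    , (λ x → ∧-zeroʳ _)

  sasaki-łukasiewicz-meet : ∀ x y → sasaki (sasaki x (y ′) ′) (y ′) ≈ x ′ ∧ y ′
  sasaki-łukasiewicz-meet x y = begin
    sasaki (((x ∨ (y ′) ′) ∧ y ′) ′) (y ′)
      ≈⟨ ∧-congʳ (∨-congʳ (deMorgan-∧ _ _)) ⟩
    (((x ∨ (y ′) ′) ′ ∨ (y ′) ′) ∨ (y ′) ′) ∧ y ′
      -- The `(y ′) ′` released by De Morgan merges with the one that the outer projection adds.
      ≈⟨ ∧-congʳ (trans (∨-assoc _ _ _) (∨-congˡ (∨-idem _))) ⟩
    sasaki ((x ∨ (y ′) ′) ′) (y ′)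
      ≈⟨ sasaki-cong (trans (′-cong (∨-congˡ (′-involutive y))) (deMorgan-∨ x y)) refl ⟩
    sasaki (x ′ ∧ y ′) (y ′)
      ≈⟨ sasaki-fixes-≤ (x∧y≤y _ _) ⟩
    x ′ ∧ y ′ ∎
    where open SetoidReasoning (Algebraic.Lattice.setoid lattice)

  -- The induced order of a near semiring is stated through joins, that of the lattice through
  -- meets; this passes between them.
  ′-antitone-∨ : ∀ {x y} → x ∨ y ≈ y → y ′ ∨ x ′ ≈ x ′
  ′-antitone-∨ {x} {y} x∨y≈y =
    x≤y⇒x∨y≈y (′-anti-≤ (≤-trans (x≤x∨y x y) (≤-reflexive x∨y≈y)))

  sasaki-isOrthomodularNearSemiring :
    IsOrthomodularNearSemiring _≈_ _∨_ sasaki _′ 0# 1#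
  sasaki-isOrthomodularNearSemiring = record
    { isŁukasiewiczNearSemiring = record
      { isInvolutiveNearSemiring = record
        { isIdempotentNearSemiring = record
          { isNearSemiring = record
            { +-isCommutativeMonoid = record
              { isMonoid = record { isSemigroup = ∨-isSemigroup ; identity = ∨-identity }
              ; comm     = ∨-comm
              }
            ; *-cong     = sasaki-cong
            ; *-identity = sasaki-identity
            ; distribʳ   = sasaki-distribʳ-∨
            ; zero       = sasaki-zero
            }
          ; +-idem = ∨-idem
          }
        ; α-cong       = ′-cong
        ; α-involutive = ′-involutive
        ; α-antitone   = ′-antitone-∨
        }
      ; łukasiewicz = λ x y →
          trans (sasaki-łukasiewicz-meet x y)
            (trans (∧-comm _ _) (sym (sasaki-łukasiewicz-meet y x)))
      }
    ; *-absorbs-+ = λ x y → sym (sasaki-fixes-≤ (x≤x∨y x y))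
    }

theorem9 : ∀ {c ℓ} (L : OrthomodularLattice c ℓ) →
    let open OrthomodularLattice L in
    IsOrthomodularNearSemiring _≈_ _∨_ sasaki _′ 0# 1#
theorem9 L = OrthomodularLatticeProperties.sasaki-isOrthomodularNearSemiring L
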